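{- For every finite simple graph $G$, $\chi_{DP}(G) \le 2\,AT(G)$.
   Context: Correspondence chromatic number: a correspondence assignment $(L,C)$ for $G$ consists of a list $L(v)$ for each vertex and, for each edge $uv$, a partial matching $C_{uv}$ between $\{u\}\times L(u)$ and $\{v\}\times L(v)$; an $(L,C)$-coloring is a choice $\phi(v)\in L(v)$ for all $v$ such that for every edge $uv$, $(u,\phi(u))$ and $(v,\phi(v))$ are not matched in $C_{uv}$; $\chi_{DP}(G)$ is the least $k$ such that $G$ has an $(L,C)$-coloring for every correspondence assignment with all lists of size $k$. Alon--Tarsi number: for a digraph $D$, an Eulerian subdigraph is a spanning subdigraph $F$ with $d^+_F(v)=d^-_F(v)$ for all $v$, even or odd according to the parity of its number of edges; $AT(G)$ is the minimum $k$ such that some orientation $D$ of $G$ has all outdegrees less than $k$ and the numbers of even and odd Eulerian subdigraphs of $D$ differ. -}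

module Defs where

open import Data.Bool using (true; false)
open import Data.Fin using (Fin)
open import Data.Fin.Properties using (all?)
open import Data.Fin.Subset using (Subset; _⊆_; ∣_∣) renaming (_∈_ to _∈ₛ_)
open import Data.Fin.Subset.Properties using (_⊆?_)
open import Data.List using (List; []; _∷_; length; filter; cartesianProductWith)
open import Data.List.Membership.Propositional using (_∈_)
open import Data.List.Membership.Propositional.Properties using (∈-cartesianProductWith⁺)
open import Data.List.Relation.Unary.All as All using ()
open import Data.List.Relation.Unary.AllPairs as AllPairs using ()
open import Data.List.Relation.Unary.Any using (here; there)
open import Data.List.Relation.Unary.Unique.Propositional using (Unique)
open import Data.List.Relation.Unary.Unique.Propositional.Properties using (cartesianProductWith⁺)
open import Data.Nat using (ℕ; zero; suc; _≤_; _<_; _≟_)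
open import Data.Nat.Divisibility using (_∣_; _∣?_)
open import Data.Product using (Σ; _×_; _,_)
open import Data.Sum using (_⊎_)
open import Data.Vec as Vec using (Vec; []; _∷_; lookup)
open import Data.Vec.Properties using (∷-injective)
open import Level using (0ℓ)
open import Relation.Binary.Core using (Rel)
open import Relation.Binary.Definitions using (Decidable; Symmetric; Irreflexive)
open import Relation.Binary.PropositionalEquality using (_≡_; _≢_; refl)
open import Relation.Nullary using (¬_; Dec)
open import Relation.Nullary.Decidable using (_×-dec_; ¬?)

IsLeast : ∀ {ℓ} → (ℕ → Set ℓ) → ℕ → Set ℓ
IsLeast P k = P k × (∀ m → P m → k ≤ m)

record Graph (n : ℕ) : Set₁ where
  infix 4 _~_ _~?_
  field
    _~_    : Rel (Fin n) 0ℓ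
    _~?_   : Decidable _~_
    sym    : Symmetric _~_
    irrefl : Irreflexive _≡_ _~_

-- The partial matchings C_uv are combined into one relation on pairs
-- (vertex , colour).  By symmetry C_uv and C_vu are the same matching, and
-- `functional` bounds the number of partners at both ends.  Decidability is
-- automatic classically.  Colours are taken from ℕ without loss of generality,
-- as a finite graph has only finitely many colours on its lists.
record CorrespondenceAssignment {n : ℕ} (G : Graph n) : Set₁ where
  open Graph G using (_~_)
  field
    L          : Fin n → List ℕ
    L-unique   : ∀ v → Unique (L v)
    Matched    : Rel (Fin n × ℕ) 0ℓ
    matched?   : Decidable Matched
    symmetric  : Symmetric Matched
    support    : ∀ {u v c d} → Matched (u , c) (v , d) →
                 u ~ v × c ∈ L u × d ∈ L v
    functional : ∀ {u v c d d′} → Matched (u , c) (v , d) →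
                 Matched (u , c) (v , d′) → d ≡ d′

IsColouring : ∀ {n} {G : Graph n} → CorrespondenceAssignment G → (Fin n → ℕ) → Set
IsColouring {G = G} A φ =
  (∀ v → φ v ∈ L v) × (∀ u v → u ~ v → ¬ Matched (u , φ u) (v , φ v))
  where
  open Graph G using (_~_)
  open CorrespondenceAssignment A

DPColourable : ∀ {n} → Graph n → ℕ → Set₁
DPColourable {n} G k =
  (A : CorrespondenceAssignment G) →
  (∀ v → length (CorrespondenceAssignment.L A v) ≡ k) →
  Σ (Fin n → ℕ) (IsColouring A)

IsDPChromaticNumber : ∀ {n} → Graph n → ℕ → Set₁
IsDPChromaticNumber G = IsLeast (DPColourable G)

-- Row u of the Boolean adjacency matrix is the set of out-neighbours of u.
Digraph : ℕ → Set
Digraph n = Vec (Subset n) n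

module _ {n : ℕ} where

  Arc : Digraph n → Fin n → Fin n → Set
  Arc D u v = v ∈ₛ lookup D u

  outdegree : Digraph n → Fin n → ℕ
  outdegree D v = ∣ lookup D v ∣

  indegree : Digraph n → Fin n → ℕ
  indegree D v = ∣ Vec.map (λ row → lookup row v) D ∣

  size : Digraph n → ℕ
  size D = Vec.sum (Vec.map ∣_∣ D)

  record IsOrientation (G : Graph n) (D : Digraph n) : Set where
    open Graph G using (_~_)
    field
      arc⇒edge : ∀ {u v} → Arc D u v → u ~ v
      edge⇒arc : ∀ {u v} → u ~ v → Arc D u v ⊎ Arc D v u
      one-way  : ∀ {u v} → Arc D u v → ¬ Arc D v u

  IsEulerianSub : Digraph n → Digraph n → Set
  IsEulerianSub D F =
    (∀ u → lookup F u ⊆ lookup D u) × (∀ v → outdegree F v ≡ indegree F v)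

  isEulerianSub? : ∀ D F → Dec (IsEulerianSub D F)
  isEulerianSub? D F =
    all? (λ u → lookup F u ⊆? lookup D u) ×-dec
    all? (λ v → outdegree F v ≟ indegree F v)

allVecs : ∀ {A : Set} → List A → ∀ n → List (Vec A n)
allVecs xs zero    = [] ∷ []
allVecs xs (suc n) = cartesianProductWith _∷_ xs (allVecs xs n)

allDigraphs : ∀ n → List (Digraph n)
allDigraphs n = allVecs (allVecs (true ∷ false ∷ []) n) n

-- Every digraph occurs exactly once in `allDigraphs`, so filtering it counts.

allVecs-complete : ∀ {A : Set} {xs : List A} → (∀ x → x ∈ xs) →
                   ∀ {n} (v : Vec A n) → v ∈ allVecs xs n
allVecs-complete h []      = here refl
allVecs-complete h (x ∷ v) =
  ∈-cartesianProductWith⁺ _∷_ (h x) (allVecs-complete h v)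

allVecs-unique : ∀ {A : Set} {xs : List A} → Unique xs → ∀ n → Unique (allVecs xs n)
allVecs-unique h zero    = All.[] AllPairs.∷ AllPairs.[]
allVecs-unique h (suc n) = cartesianProductWith⁺ _∷_ ∷-injective h (allVecs-unique h n)

allDigraphs-complete : ∀ {n} (D : Digraph n) → D ∈ allDigraphs n
allDigraphs-complete = allVecs-complete (allVecs-complete
  λ { true → here refl ; false → there (here refl) })

allDigraphs-unique : ∀ n → Unique (allDigraphs n)
allDigraphs-unique n = allVecs-unique (allVecs-unique
  (((λ ()) All.∷ All.[]) AllPairs.∷ All.[] AllPairs.∷ AllPairs.[]) n) n

#evenEulerian : ∀ {n} → Digraph n → ℕ
#evenEulerian {n} D =
  length (filter (λ F → isEulerianSub? D F ×-dec (2 ∣? size F)) (allDigraphs n))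

#oddEulerian : ∀ {n} → Digraph n → ℕ
#oddEulerian {n} D =
  length (filter (λ F → isEulerianSub? D F ×-dec ¬? (2 ∣? size F)) (allDigraphs n))

record AlonTarsiOrientation {n : ℕ} (G : Graph n) (k : ℕ) : Set where
  field
    D             : Digraph n
    isOrientation : IsOrientation G D
    outdegree<k   : ∀ v → outdegree D v < k
    even≢odd      : #evenEulerian D ≢ #oddEulerian D

IsAlonTarsiNumber : ∀ {n} → Graph n → ℕ → Set
IsAlonTarsiNumber G = IsLeast (AlonTarsiOrientation G)

{-# OPTIONS --safe #-}
-- An orientation with all outdegrees below k makes G "(2k − 2)-degenerate": on
-- every nonempty vertex set S the indegrees within S sum to the number of arcs
-- within S, which is less than k ∣S∣, so some v ∈ S has fewer than k in-neighbours
-- and fewer than k out-neighbours in S.  Colouring such a v last, each of its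
-- neighbours forbids at most one of its 2k colours.
module Submission where

open import Defs
open import Data.Fin using (Fin; _≟_)
open import Data.Fin.Subset using (Subset; ∣_∣) renaming (_∈_ to _∈ₛ_)
open import Data.Fin.Subset.Properties
  using (x∈p⇒∣p-x∣<∣p∣; x∈p∧x≢y⇒x∈p-y) renaming (_∈?_ to _∈ₛ?_)
open import Data.List using (List; []; _∷_; _++_; length; filter; map; allFin)
open import Data.List.Membership.Propositional using (_∈_; lose)
open import Data.List.Membership.Propositional.Properties
  using (∈-filter⁺; ∈-filter⁻; ∈-++⁺ˡ; ∈-++⁺ʳ; ∈-allFin; ∈-length)
open import Data.List.Properties using (filter-notAll; length-++)
open import Data.List.Relation.Unary.All as All using (All; []; _∷_)
open import Data.List.Relation.Unary.All.Properties using (all-filter)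
open import Data.List.Relation.Unary.AllPairs using ([]; _∷_)
open import Data.List.Relation.Unary.Any using (here; there)
open import Data.List.Relation.Unary.Unique.Propositional using (Unique)
open import Data.List.Relation.Unary.Unique.Propositional.Properties using (allFin⁺; filter⁺)
open import Data.Nat using (ℕ; suc; pred; _+_; _*_; _≤_; _<_; _<?_; z≤n; s≤s)
open import Data.Nat.ListAction using (sum)
open import Data.Nat.Properties hiding (_≟_; _<?_)
open import Algebra.Properties.CommutativeSemigroup +-commutativeSemigroup using (x∙yz≈y∙xz)
open import Data.Product using (_×_; _,_; proj₁; proj₂; ∃-syntax)
open import Data.Sum using (_⊎_; inj₁; inj₂)
open import Data.Vec using (lookup)
open import Data.Vec.Functional using (updateAt)
open import Data.Vec.Functional.Properties using (updateAt-updates; updateAt-minimal)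
open import Function using (const; flip)
open import Relation.Binary.Core using (REL)
open import Relation.Binary.Definitions using () renaming (Decidable to Decidable₂)
open import Relation.Binary.PropositionalEquality
  using (_≡_; _≢_; refl; sym; trans; cong; subst; subst₂)
open import Relation.Nullary using (¬_; yes; no; contradiction)
open import Relation.Nullary.Decidable using (¬?)
open import Relation.Unary using (Pred; Decidable)

count : ∀ {a p} {A : Set a} {P : Pred A p} → Decidable P → List A → ℕ
count P? xs = length (filter P? xs)

module _ {a} {A : Set a} where

  sum-map-zero : (xs : List A) → sum (map (const 0) xs) ≡ 0
  sum-map-zero []       = refl
  sum-map-zero (x ∷ xs) = sum-map-zero xs

  sum<⇒∃< : ∀ (f : A → ℕ) k xs → sum (map f xs) < length xs * k →
            ∃[ x ] x ∈ xs × f x < k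
  sum<⇒∃< f k (x ∷ xs) sum< with f x <? k
  ... | yes fx<k = x , here refl , fx<k
  ... | no  fx≮k =
    let y , y∈xs , fy<k = sum<⇒∃< f k xs
          (+-cancelˡ-< k _ _ (≤-<-trans (+-monoˡ-≤ _ (≮⇒≥ fx≮k)) sum<))
    in  y , there y∈xs , fy<k

  count<1⇒¬ : ∀ {p} {P : Pred A p} (P? : Decidable P) {xs x} →
              count P? xs < 1 → x ∈ xs → ¬ P x
  count<1⇒¬ P? count<1 x∈xs Px =
    <⇒≱ count<1 (∈-length (∈-filter⁺ P? x∈xs Px))

  unique-constant⇒length≤1 : ∀ {xs : List A} → Unique xs →
    (∀ {x y} → x ∈ xs → y ∈ xs → x ≡ y) → length xs ≤ 1
  unique-constant⇒length≤1 {[]}        _              _  = z≤n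
  unique-constant⇒length≤1 {_ ∷ []}    _              _  = s≤s z≤n
  unique-constant⇒length≤1 {_ ∷ _ ∷ _} ((x≢y ∷ _) ∷ _) eq =
    contradiction (eq (here refl) (there (here refl))) x≢y

module _ {a b r} {A : Set a} {B : Set b} {R : REL A B r} (R? : Decidable₂ R) where

  sum-count-∷ : ∀ y ys xs →
    sum (map (λ x → count (R? x) (y ∷ ys)) xs) ≡
    count (λ x → R? x y) xs + sum (map (λ x → count (R? x) ys) xs)
  sum-count-∷ y ys []       = refl
  sum-count-∷ y ys (x ∷ xs) with R? x y
  ... | yes _ = cong suc (trans (cong (count (R? x) ys +_) (sum-count-∷ y ys xs))
                                (x∙yz≈y∙xz (count (R? x) ys) (count (λ x → R? x y) xs) _))
  ... | no  _ = trans (cong (count (R? x) ys +_) (sum-count-∷ y ys xs))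
                      (x∙yz≈y∙xz (count (R? x) ys) (count (λ x → R? x y) xs) _)

  -- Double counting: the related pairs are regrouped by their second entry, and each `y` accounts
  -- for at most `j` of them.
  sum-count-≤ : ∀ {j} xs ys → (∀ {y} → y ∈ ys → count (λ x → R? x y) xs ≤ j) →
                sum (map (λ x → count (R? x) ys) xs) ≤ length ys * j
  sum-count-≤ xs []       _ = ≤-reflexive (sum-map-zero xs)
  sum-count-≤ xs (y ∷ ys) h = ≤-trans (≤-reflexive (sum-count-∷ y ys xs))
    (+-mono-≤ (h (here refl)) (sum-count-≤ xs ys (λ y∈ys → h (there y∈ys))))

  -- The averaging step behind both halves of the argument: it is applied to arcs to find a vertex
  -- of small indegree, and to colours against neighbours to find a free colour.
  ∃-count< : ∀ {j k} xs ys → length ys * j < length xs * k →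
             (∀ {y} → y ∈ ys → count (λ x → R? x y) xs ≤ j) →
             ∃[ x ] x ∈ xs × count (R? x) ys < k
  ∃-count< {k = k} xs ys lt h = sum<⇒∃< _ k xs (≤-<-trans (sum-count-≤ xs ys h) lt)

  -- Averaging with both bounds equal to 1: each `y` rules out at most one `x`, and there are fewer
  -- `y`s than `x`s.
  ∃-unrelated : ∀ {xs ys} → Unique xs → length ys < length xs →
                (∀ {x x′ y} → R x y → R x′ y → x ≡ x′) →
                ∃[ x ] x ∈ xs × (∀ {y} → y ∈ ys → ¬ R x y)
  ∃-unrelated {xs} {ys} xs! lt inj =
    let x , x∈xs , count<1 = ∃-count< {1} {1} xs ys
          (subst₂ _<_ (sym (*-identityʳ _)) (sym (*-identityʳ _)) lt)
          (λ {y} _ → unique-constant⇒length≤1 (filter⁺ (λ x → R? x y) xs!)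
            (λ p q → inj (proj₂ (∈-filter⁻ (λ x → R? x y) {xs = xs} p))
                         (proj₂ (∈-filter⁻ (λ x → R? x y) {xs = xs} q))))
    in  x , x∈xs , count<1⇒¬ (R? x) count<1

-- Carries the bound on `outdegree`, a cardinality of a `Subset`, over to counts in lists. Removing
-- the head from `p` keeps the tail inside by uniqueness.
unique-length≤∣∣ : ∀ {n} {xs : List (Fin n)} {p : Subset n} →
                   Unique xs → All (_∈ₛ p) xs → length xs ≤ ∣ p ∣
unique-length≤∣∣ []          []             = z≤n
unique-length≤∣∣ (x∉xs ∷ xs!) (x∈p ∷ xs⊆p) =
  ≤-<-trans (unique-length≤∣∣ xs! (All.zipWith
              (λ (y∈p , x≢y) → x∈p∧x≢y⇒x∈p-y y∈p (λ y≡x → x≢y (sym y≡x))) (xs⊆p , x∉xs)))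
            (x∈p⇒∣p-x∣<∣p∣ x∈p)

module _ {n : ℕ} (D : Digraph n) where

  arc? : Decidable₂ (Arc D)
  arc? u v = v ∈ₛ? lookup D u

  -- In-neighbours first, then out-neighbours, so that the length splits into two counts, each
  -- bounded by its own argument.
  neighboursIn : List (Fin n) → Fin n → List (Fin n)
  neighboursIn S v = filter (λ u → arc? u v) S ++ filter (arc? v) S

  ∈-neighboursIn : ∀ {S u v} → u ∈ S → Arc D u v ⊎ Arc D v u → u ∈ neighboursIn S v
  ∈-neighboursIn {v = v} u∈S (inj₁ uv) = ∈-++⁺ˡ (∈-filter⁺ (λ u → arc? u v) u∈S uv)
  ∈-neighboursIn {v = v} u∈S (inj₂ vu) = ∈-++⁺ʳ _ (∈-filter⁺ (arc? v) u∈S vu)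

module _ {n k : ℕ} (D : Digraph n) (outdegree<k : ∀ v → outdegree D v < k) where

  count-out<k : ∀ {S} → Unique S → ∀ v → count (arc? D v) S < k
  count-out<k {S} S! v = ≤-<-trans
    (unique-length≤∣∣ (filter⁺ (arc? D v) S!) (all-filter (arc? D v) S)) (outdegree<k v)

  ∃-few-neighbours : ∀ {w S} → Unique (w ∷ S) →
    ∃[ v ] v ∈ w ∷ S × length (neighboursIn D (w ∷ S) v) < 2 * k
  ∃-few-neighbours {w} {S} S! =
    -- After `flip`, the averaged count is the indegree within the list and the uniform bound is
    -- `pred k` on outdegrees. The average is strictly below `k` because the list is nonempty and
    -- `k` is positive, the latter by `outdegree<k w`.
    let v , v∈S , in<k = ∃-count< (flip (arc? D)) (w ∷ S) (w ∷ S)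
          (*-monoʳ-< (length (w ∷ S)) (pred<k (outdegree<k w)))
          (λ {y} _ → <⇒≤pred (count-out<k S! y))
    in  v , v∈S , subst₂ _<_ (sym (length-++ (filter (λ u → arc? D u v) (w ∷ S))))
                             (cong (k +_) (sym (+-identityʳ k)))
                             (+-mono-< in<k (count-out<k S! v))
    where
    pred<k : ∀ {m k} → m < k → pred k < k
    pred<k (s≤s _) = ≤-refl

module _ {n k : ℕ} {G : Graph n} {D : Digraph n}
         (isOrientation : IsOrientation G D) (outdegree<k : ∀ v → outdegree D v < k)
         (A : CorrespondenceAssignment G)
         (∣L∣≡2k : ∀ v → length (CorrespondenceAssignment.L A v) ≡ 2 * k) where

  open Graph G using (_~_; irrefl)
  open IsOrientation isOrientation
  open CorrespondenceAssignment A

  -- A partial colouring is a total function whose values outside `S` are arbitrary. Properness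
  -- ranges over all pairs in `S`, since `support` makes matched vertices adjacent.
  IsColouringOn : List (Fin n) → (Fin n → ℕ) → Set
  IsColouringOn S φ =
    (∀ {v} → v ∈ S → φ v ∈ L v) ×
    (∀ {u v} → u ∈ S → v ∈ S → ¬ Matched (u , φ u) (v , φ v))

  extend : ∀ {S} v {c} (φ : Fin n → ℕ) → c ∈ L v →
    IsColouringOn (filter (λ u → ¬? (u ≟ v)) S) φ →
    (∀ {u} → u ∈ S → ¬ Matched (v , c) (u , φ u)) →
    IsColouringOn S (updateAt φ v (const c))
  extend {S} v {c} φ c∈L (φ∈L , proper) free = φ′∈L , proper′
    where
    φ′ : Fin n → ℕ
    φ′ = updateAt φ v (const c)

    φ′v≡c : φ′ v ≡ c
    φ′v≡c = updateAt-updates v φ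

    φ′≡φ : ∀ {u} → u ≢ v → φ′ u ≡ φ u
    φ′≡φ {u} = updateAt-minimal u v φ

    ∈S-v : ∀ {u} → u ∈ S → u ≢ v → u ∈ filter (λ u → ¬? (u ≟ v)) S
    ∈S-v = ∈-filter⁺ (λ u → ¬? (u ≟ v))

    φ′∈L : ∀ {u} → u ∈ S → φ′ u ∈ L u
    φ′∈L {u} u∈S with u ≟ v
    ... | yes refl = subst (_∈ L u) (sym φ′v≡c) c∈L
    ... | no  u≢v  = subst (_∈ L u) (sym (φ′≡φ u≢v)) (φ∈L (∈S-v u∈S u≢v))

    free′ : ∀ {u} → u ∈ S → u ≢ v → ¬ Matched (v , φ′ v) (u , φ′ u)
    free′ {u} u∈S u≢v m =
      free u∈S (subst₂ (λ a b → Matched (v , a) (u , b)) φ′v≡c (φ′≡φ u≢v) m)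

    proper′ : ∀ {u w} → u ∈ S → w ∈ S → ¬ Matched (u , φ′ u) (w , φ′ w)
    -- Only pairs involving `v` see a new colour. A pair of two copies of `v` would be a loop; a
    -- mixed pair is excluded by `free`, up to symmetry.
    proper′ {u} {w} u∈S w∈S m with u ≟ v | w ≟ v
    ... | yes refl | yes refl = irrefl refl (proj₁ (support m))
    ... | yes refl | no  w≢v  = free′ w∈S w≢v m
    ... | no  u≢v  | yes refl = free′ u∈S u≢v (symmetric m)
    ... | no  u≢v  | no  w≢v  = proper (∈S-v u∈S u≢v) (∈S-v w∈S w≢v)
      (subst₂ (λ a b → Matched (u , a) (w , b)) (φ′≡φ u≢v) (φ′≡φ w≢v) m)

  -- Once `u` has colour `φ u`, `functional` read from the side of `u` leaves at most one colour of
  -- `v` matched to it.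
  ∃-free-colour : ∀ {S} v (φ : Fin n → ℕ) → length (neighboursIn D S v) < 2 * k →
    ∃[ c ] c ∈ L v × (∀ {u} → u ∈ S → ¬ Matched (v , c) (u , φ u))
  ∃-free-colour v φ few =
    let c , c∈L , free = ∃-unrelated (λ c u → matched? (v , c) (u , φ u)) (L-unique v)
          (subst (_ <_) (sym (∣L∣≡2k v)) few)
          (λ p q → functional (symmetric p) (symmetric q))
    -- A match forces an edge, hence an arc one way or the other, so avoiding conflicts with
    -- `neighboursIn D S v` covers all of `S`.
    in  c , c∈L , λ u∈S m →
          free (∈-neighboursIn D u∈S
                 (edge⇒arc (proj₁ (support (symmetric m))))) m

  -- The bound `m` is the recursion measure, since the filtered list is not a structural part of
  -- `S`. The vertex with few neighbours is chosen first but coloured last.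
  colourOn : ∀ m S → length S ≤ m → Unique S → ∃[ φ ] IsColouringOn S φ
  colourOn _       []        _  _  = const 0 , (λ ()) , λ ()
  colourOn (suc m) S@(_ ∷ _) ∣S∣≤m S! =
    let v , v∈S , few   = ∃-few-neighbours D outdegree<k S!
        φ , φ-colouring = colourOn m (filter (λ u → ¬? (u ≟ v)) S)
          (≤-pred (≤-trans
            (filter-notAll (λ u → ¬? (u ≟ v)) S (lose v∈S (λ v≢v → v≢v refl))) ∣S∣≤m))
          (filter⁺ (λ u → ¬? (u ≟ v)) S!)
        c , c∈L , free  = ∃-free-colour v φ few
    in  updateAt φ v (const c) , extend v φ c∈L φ-colouring free

  colouring : ∃[ φ ] IsColouring A φ
  colouring =
    let φ , φ∈L , proper = colourOn _ (allFin n) ≤-refl (allFin⁺ n)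
    in  φ , (λ v → φ∈L (∈-allFin v)) , λ u v _ → proper (∈-allFin u) (∈-allFin v)

theorem4 : ∀ (n : ℕ) (G : Graph n) (χDP AT : ℕ) →
    IsDPChromaticNumber G χDP → IsAlonTarsiNumber G AT → χDP ≤ 2 * AT
theorem4 n G χDP AT (_ , χDP-least) (orientation , _) =
  χDP-least (2 * AT) (colouring isOrientation outdegree<k)
  where open AlonTarsiOrientation orientation
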